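{- Let $n\ge 5$ and let $G$ be an $n$-vertex $3$-graph containing no tight path $P_4^3$ with four edges. Then $e(G)\le|\partial(G)|$.
   Context: A $3$-graph is a (finite) $3$-uniform hypergraph; $e(G)$ is the number of edges of $G$. The shadow of a $3$-graph $G$ is $\partial(G)=\{S: |S|=2,\ S\subseteq e\text{ for some }e\in E(G)\}$. The $3$-uniform tight path $P_4^3$ with four edges is the $3$-graph on six distinct vertices $v_1,\dots,v_6$ with edges $\{v_1,v_2,v_3\},\{v_2,v_3,v_4\},\{v_3,v_4,v_5\},\{v_4,v_5,v_6\}$. $G$ contains $P_4^3$ if there is an injection $V(P_4^3)\to V(G)$ mapping every edge of $P_4^3$ to an edge of $G$. -}

module Defs where

open import Data.Bool.Properties using () renaming (_≟_ to _≟ᵇ_)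
open import Data.Fin using (Fin; #_)
open import Data.Fin.Properties using (_≟_; any?)
open import Data.Fin.Subset using (Subset; inside; outside; ⁅_⁆; _∪_; _⊆_; ∣_∣)
open import Data.Fin.Subset.Properties using (_∈?_; _⊆?_)
open import Data.List using (List; []; _∷_; _++_; map; filter; length)
open import Data.List.Membership.Propositional using (_∈_; find; lose)
open import Data.List.Membership.Propositional.Properties
  using (∈-map⁺; ∈-map⁻; ∈-++⁺ˡ; ∈-++⁺ʳ; ∈-filter⁺; ∈-filter⁻)
import Data.List.Relation.Unary.All as All
import Data.List.Relation.Unary.Any as Any
open import Data.List.Relation.Unary.All using (All)
open import Data.List.Relation.Unary.Any using (Any; here)
open import Data.List.Relation.Unary.AllPairs using ([]; _∷_; allPairs?)
open import Data.List.Relation.Unary.Unique.Propositional using (Unique)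
import Data.List.Relation.Unary.Unique.Propositional.Properties as Unique
open import Data.Nat using (ℕ; zero; suc) renaming (_≟_ to _≟ⁿ_)
open import Data.Product using (∃-syntax; _×_; _,_)
open import Data.Vec using (tabulate; []; _∷_)
open import Data.Vec.Properties using (≡-dec; ∷-injectiveʳ)
open import Function.Bundles using (_⇔_; mk⇔)
open import Function.Definitions using (Injective)
open import Relation.Binary.PropositionalEquality using (_≡_; refl)
open import Relation.Nullary using (Dec; does; ¬?; _×-dec_)
open import Relation.Nullary.Decidable using (from-yes)

-- The vertex set is Fin n; the edge set is a duplicate-free list, so that
-- its length is the number of edges.
record 3Graph (n : ℕ) : Set where
  field
    edges   : List (Subset n)
    unique  : Unique edges
    uniform : All (λ S → ∣ S ∣ ≡ 3) edges

open 3Graph public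

e : ∀ {n} → 3Graph n → ℕ
e G = length (edges G)

allSubsets : ∀ n → List (Subset n)
allSubsets zero    = [] ∷ []
allSubsets (suc n) =
  map (inside ∷_) (allSubsets n) ++ map (outside ∷_) (allSubsets n)

InShadow : ∀ {n} → 3Graph n → Subset n → Set
InShadow G S = ∣ S ∣ ≡ 2 × Any (S ⊆_) (edges G)

inShadow? : ∀ {n} (G : 3Graph n) (S : Subset n) → Dec (InShadow G S)
inShadow? G S = (∣ S ∣ ≟ⁿ 2) ×-dec Any.any? (S ⊆?_) (edges G)

∂ : ∀ {n} → 3Graph n → List (Subset n)
∂ {n} G = filter (inShadow? G) (allSubsets n)

image : ∀ {m n} → (Fin m → Fin n) → Subset m → Subset n
image f S = tabulate λ y → does (any? λ x → (x ∈? S) ×-dec (f x ≟ y))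

_Contains_ : ∀ {n m} → 3Graph n → 3Graph m → Set
_Contains_ {n} {m} G H =
  ∃[ f ] Injective {A = Fin m} {B = Fin n} _≡_ _≡_ f
       × (∀ {S} → S ∈ edges H → image f S ∈ edges G)

triple : ∀ {n} → Fin n → Fin n → Fin n → Subset n
triple x y z = ⁅ x ⁆ ∪ ⁅ y ⁆ ∪ ⁅ z ⁆

P₄³ : 3Graph 6
P₄³ = record
  { edges   = es
  ; unique  = from-yes (allPairs? (λ S T → ¬? (≡-dec _≟ᵇ_ S T)) es)
  ; uniform = from-yes (All.all? (λ S → ∣ S ∣ ≟ⁿ 3) es)
  }
  where
  es : List (Subset 6)
  es = triple (# 0) (# 1) (# 2)
     ∷ triple (# 1) (# 2) (# 3)
     ∷ triple (# 2) (# 3) (# 4)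
     ∷ triple (# 3) (# 4) (# 5)
     ∷ []

-- The list ∂ G enumerates the shadow without repetition, so its length is
-- the cardinality of the shadow.

∈-allSubsets : ∀ {n} (S : Subset n) → S ∈ allSubsets n
∈-allSubsets []            = here refl
∈-allSubsets (inside  ∷ S) = ∈-++⁺ˡ (∈-map⁺ (inside ∷_) (∈-allSubsets S))
∈-allSubsets (outside ∷ S) = ∈-++⁺ʳ _ (∈-map⁺ (outside ∷_) (∈-allSubsets S))

allSubsets-unique : ∀ n → Unique (allSubsets n)
allSubsets-unique zero    = All.[] ∷ []
allSubsets-unique (suc n) =
  Unique.++⁺ (Unique.map⁺ ∷-injectiveʳ (allSubsets-unique n))
             (Unique.map⁺ ∷-injectiveʳ (allSubsets-unique n))
             λ { (p , q) → disjoint (∈-map⁻ (inside ∷_) p) (∈-map⁻ (outside ∷_) q) }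
  where
  open import Data.Empty using (⊥)
  disjoint : ∀ {S : Subset (suc n)}
           → ∃[ T ] (T ∈ allSubsets n × S ≡ inside ∷ T)
           → ∃[ T ] (T ∈ allSubsets n × S ≡ outside ∷ T) → ⊥
  disjoint (_ , _ , refl) (_ , _ , ())

∂-unique : ∀ {n} (G : 3Graph n) → Unique (∂ G)
∂-unique {n} G = Unique.filter⁺ (inShadow? G) (allSubsets-unique n)

∈-∂ : ∀ {n} (G : 3Graph n) (S : Subset n) →
      S ∈ ∂ G ⇔ (∣ S ∣ ≡ 2 × ∃[ E ] (E ∈ edges G × S ⊆ E))
∈-∂ {n} G S = mk⇔
  (λ S∈ → let _ , c , a = ∈-filter⁻ (inShadow? G) {xs = allSubsets n} S∈ in c , find a)
  (λ { (c , _ , E∈ , S⊆E) →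
       ∈-filter⁺ (inShadow? G) (∈-allSubsets S) (c , lose E∈ (λ {x} → S⊆E {x})) })

{-# OPTIONS --safe #-}

-- A minimal counterexample has no set P of shadow pairs that lies in at most |P| edges,
-- since deleting those edges destroys all of P.  So every shadow pair has codegree at
-- least 2.  If some pair ab has codegree at least 4, then N(cd) = {a , b}
-- whenever c ∈ N(ab) and a ≢ d ∈ N(bc): a further e ∈ N(cd) would give a path a′ a b c d e.
-- Hence N(ac) ∖ b = N(bc) ∖ a, and if this set is a single vertex d, then the pairs ac, bc,
-- cd lie only in the edges abc, acd, bcd.  If it is never a single vertex, any two vertices
-- c, x of N(ab) are joined in the links of a and b, since y x a b c d is not a path for
-- y ∈ N(ax), d ∈ N(bc); four such vertices yield the path c₁ c₂ a c₃ b c₄.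
-- So all codegrees are at most 3, and 3 e(G) ≤ 3 |∂G| by double counting.
module Submission where

open import Defs
open import Data.Bool using (true; false)
open import Data.Bool.Properties using () renaming (_≟_ to _≟ᵇ_)
open import Data.Fin using (Fin; zero; suc; #_)
open import Data.Fin.Properties using (_≟_; any?)
open import Data.Fin.Subset using (Subset; inside; outside; ⁅_⁆; _∪_; _⊆_; ∣_∣; Nonempty)
  renaming (_∈_ to _∈ˢ_; _∉_ to _∉ˢ_)
open import Data.Fin.Subset.Properties
  using (_∈?_; _⊆?_; nonempty?; Empty-unique; ∣⊥∣≡0; ∣⁅x⁆∣≡1; x∈⁅x⁆; x∈⁅y⁆⇒x≡y;
         x∈p∪q⁻; x∈p∪q⁺; q⊆p∪q; ⊆-antisym; p⊆q⇒∣p∣≤∣q∣;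
         ∪-identityˡ; ∪-identityʳ; ∪-comm; ∪-assoc; ∪-idem)
open import Data.List using (List; []; _∷_; _++_; length; map; filter)
open import Data.List.Properties using (length-++; length-map; filter-notAll)
open import Data.List.Membership.Propositional using (_∈_; _∉_; find; lose)
open import Data.List.Membership.Propositional.Properties
  using (∈-map⁺; ∈-++⁺ˡ; ∈-++⁺ʳ; ∈-++⁻; ∈-filter⁺; ∈-filter⁻)
open import Data.List.Relation.Unary.All as All using (All)
import Data.List.Relation.Unary.All.Properties as All
open import Data.List.Relation.Unary.Any as Any using (here; there)
open import Data.List.Relation.Unary.AllPairs using ([]; _∷_)
open import Data.List.Relation.Unary.Unique.Propositional using (Unique)
import Data.List.Relation.Unary.Unique.Propositional.Properties as Unique
open import Data.Nat using (ℕ; suc; _+_; _*_; _≤_; _<_; _≤?_; z≤n; s≤s)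
open import Data.Nat.Induction using (<-wellFounded)
open import Data.Nat.ListAction using (sum)
open import Data.Nat.Properties
  using (≤-refl; ≤-reflexive; ≤-trans; <⇒≱; ≰⇒>; +-mono-≤; suc-injective; *-cancelʳ-≤;
         +-commutativeSemigroup; module ≤-Reasoning)
open import Algebra.Properties.CommutativeSemigroup +-commutativeSemigroup using (x∙yz≈y∙xz)
open import Data.Product using (∃-syntax; _×_; _,_; proj₁; proj₂)
open import Data.Sum using (_⊎_; inj₁; inj₂)
open import Data.Vec as Vec using (lookup; []; _∷_)
open import Data.Vec.Properties using (≡-dec; lookup∘tabulate; []=⇒lookup; lookup⇒[]=)
import Data.Vec.Relation.Unary.All as Vecᴬ
import Data.Vec.Relation.Unary.AllPairs as Vecᴾ
open import Data.Vec.Relation.Unary.Unique.Propositional.Properties using (lookup-injective)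
open import Function using (_∘_)
open import Function.Bundles using (Equivalence)
open import Induction.WellFounded using (Acc; acc)
open import Relation.Binary.PropositionalEquality
  using (_≡_; _≢_; refl; sym; trans; cong; subst)
open import Relation.Nullary using (¬_; Dec; yes; no; ¬?; does; _×-dec_; contradiction)
open import Relation.Nullary.Decidable using (dec-true)

private
  variable
    n m : ℕ
    A B : Set

_≟ˢ_ : (S T : Subset n) → Dec (S ≡ T)
_≟ˢ_ = ≡-dec _≟ᵇ_

_∈ᴸ?_ : (S : Subset n) (xs : List (Subset n)) → Dec (S ∈ xs)
S ∈ᴸ? xs = Any.any? (S ≟ˢ_) xs

-- Counting in lists

-- Induction on `xs`: filtering its head out of `ys` costs at least one entry, while the tail
-- survives because `xs` is duplicate-free.
Unique-⊆⇒length≤ : {xs ys : List (Subset n)} → Unique xs → (∀ {x} → x ∈ xs → x ∈ ys) →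
                   length xs ≤ length ys
Unique-⊆⇒length≤ []         _     = z≤n
Unique-⊆⇒length≤ {xs = x ∷ xs} {ys} (x∉ ∷ u) xs⊆ys =
  ≤-trans (s≤s (Unique-⊆⇒length≤ u xs⊆ys∖x))
          (filter-notAll ≢x? ys (Any.map (λ eq neq → neq eq) (xs⊆ys (here refl))))
  where
  ≢x? = λ y → ¬? (x ≟ˢ y)
  xs⊆ys∖x : ∀ {y} → y ∈ xs → y ∈ filter ≢x? ys
  xs⊆ys∖x y∈ = ∈-filter⁺ ≢x? (xs⊆ys (there y∈)) (All.lookup x∉ y∈)

pigeonhole : {xs : List (Subset n)} (ys : List (Subset n)) → Unique xs → length ys < length xs →
             ∃[ x ] x ∈ xs × x ∉ ys
pigeonhole {xs = xs} ys u ys<xs with Any.any? (λ x → ¬? (x ∈ᴸ? ys)) xs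
... | yes some = find some
... | no none  = contradiction (Unique-⊆⇒length≤ u xs⊆ys) (<⇒≱ ys<xs)
  where
  xs⊆ys : ∀ {x} → x ∈ xs → x ∈ ys
  xs⊆ys {x} x∈ with x ∈ᴸ? ys
  ... | yes p = p
  ... | no ¬p = contradiction (lose x∈ ¬p) none

length*≤sum : ∀ k (f : A → ℕ) {xs} → All (λ x → k ≤ f x) xs → length xs * k ≤ sum (map f xs)
length*≤sum k f All.[]         = z≤n
length*≤sum k f (px All.∷ pxs) = +-mono-≤ px (length*≤sum k f pxs)

sum≤length* : ∀ k (f : A → ℕ) {xs} → All (λ x → f x ≤ k) xs → sum (map f xs) ≤ length xs * k
sum≤length* k f All.[]         = z≤n
sum≤length* k f (px All.∷ pxs) = +-mono-≤ px (sum≤length* k f pxs)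

module _ {R : A → B → Set} (R? : ∀ a b → Dec (R a b)) where

  degˡ : List B → A → ℕ
  degˡ ys a = length (filter (R? a) ys)

  degʳ : List A → B → ℕ
  degʳ xs b = length (filter (λ a → R? a b) xs)

  sum-degʳ-∷ : ∀ a xs ys →
               degˡ ys a + sum (map (degʳ xs) ys) ≡ sum (map (degʳ (a ∷ xs)) ys)
  sum-degʳ-∷ a xs [] = refl
  sum-degʳ-∷ a xs (b ∷ ys) with sum-degʳ-∷ a xs ys | does (R? a b)
  ... | ih | true  = cong suc (trans (x∙yz≈y∙xz (degˡ ys a) (degʳ xs b) _) (cong (degʳ xs b +_) ih))
  ... | ih | false = trans (x∙yz≈y∙xz (degˡ ys a) (degʳ xs b) _) (cong (degʳ xs b +_) ih)

  -- Both sides count the related pairs; `xs` is consumed one row at a time.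
  sum-degˡ≡sum-degʳ : ∀ xs ys → sum (map (degˡ ys) xs) ≡ sum (map (degʳ xs) ys)
  sum-degˡ≡sum-degʳ [] []       = refl
  sum-degˡ≡sum-degʳ [] (b ∷ ys) = sum-degˡ≡sum-degʳ [] ys
  sum-degˡ≡sum-degʳ (a ∷ xs) ys =
    trans (cong (degˡ ys a +_) (sum-degˡ≡sum-degʳ xs ys)) (sum-degʳ-∷ a xs ys)

  double-count : ∀ k l {xs ys} → All (λ a → degˡ ys a ≤ l) xs → All (λ b → k ≤ degʳ xs b) ys →
                 length ys * k ≤ length xs * l
  double-count k l {xs} {ys} ≤l k≤ = begin
    length ys * k             ≤⟨ length*≤sum k (degʳ xs) k≤ ⟩
    sum (map (degʳ xs) ys)    ≡⟨ sum-degˡ≡sum-degʳ xs ys ⟨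
    sum (map (degˡ ys) xs)    ≤⟨ sum≤length* l (degˡ ys) ≤l ⟩
    length xs * l             ∎
    where open ≤-Reasoning

-- Pairs and triples as subsets

pair : Fin n → Fin n → Subset n
pair x y = ⁅ x ⁆ ∪ ⁅ y ⁆

pair-comm : (x y : Fin n) → pair x y ≡ pair y x
pair-comm x y = ∪-comm ⁅ x ⁆ ⁅ y ⁆

∈-pair⁻ : {v x y : Fin n} → v ∈ˢ pair x y → v ≡ x ⊎ v ≡ y
∈-pair⁻ {x = x} {y} v∈ with x∈p∪q⁻ ⁅ x ⁆ ⁅ y ⁆ v∈
... | inj₁ p = inj₁ (x∈⁅y⁆⇒x≡y _ p)
... | inj₂ p = inj₂ (x∈⁅y⁆⇒x≡y _ p)

∈-pairˡ : (x y : Fin n) → x ∈ˢ pair x y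
∈-pairˡ x y = x∈p∪q⁺ (inj₁ (x∈⁅x⁆ x))

∈-pairʳ : (x y : Fin n) → y ∈ˢ pair x y
∈-pairʳ x y = x∈p∪q⁺ (inj₂ (x∈⁅x⁆ y))

pair-≢ : {v w x y : Fin n} → v ≢ x → v ≢ y → pair v w ≢ pair x y
pair-≢ {v = v} {w} v≢x v≢y eq with ∈-pair⁻ (subst (v ∈ˢ_) eq (∈-pairˡ v w))
... | inj₁ p = v≢x p
... | inj₂ p = v≢y p

∈-triple⁻ : {v x y z : Fin n} → v ∈ˢ triple x y z → v ≡ x ⊎ v ≡ y ⊎ v ≡ z
∈-triple⁻ {x = x} {y} {z} v∈ with x∈p∪q⁻ ⁅ x ⁆ (pair y z) v∈
... | inj₁ p = inj₁ (x∈⁅y⁆⇒x≡y _ p)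
... | inj₂ p = inj₂ (∈-pair⁻ p)

∈-triple⁺ : {v x y z : Fin n} → v ≡ x ⊎ v ≡ y ⊎ v ≡ z → v ∈ˢ triple x y z
∈-triple⁺ (inj₁ refl)        = x∈p∪q⁺ (inj₁ (x∈⁅x⁆ _))
∈-triple⁺ (inj₂ (inj₁ refl)) = x∈p∪q⁺ (inj₂ (∈-pairˡ _ _))
∈-triple⁺ (inj₂ (inj₂ refl)) = x∈p∪q⁺ (inj₂ (∈-pairʳ _ _))

triple-swap₁₂ : (x y z : Fin n) → triple x y z ≡ triple y x z
triple-swap₁₂ x y z = trans (sym (∪-assoc ⁅ x ⁆ ⁅ y ⁆ ⁅ z ⁆))
  (trans (cong (_∪ ⁅ z ⁆) (pair-comm x y)) (∪-assoc ⁅ y ⁆ ⁅ x ⁆ ⁅ z ⁆))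

triple-swap₂₃ : (x y z : Fin n) → triple x y z ≡ triple x z y
triple-swap₂₃ x y z = cong (⁅ x ⁆ ∪_) (pair-comm y z)

pair⊆triple : (x y z : Fin n) → pair x y ⊆ triple x y z
pair⊆triple x y z v∈ with ∈-pair⁻ v∈
... | inj₁ p = ∈-triple⁺ (inj₁ p)
... | inj₂ p = ∈-triple⁺ (inj₂ (inj₁ p))

∣⁅x⁆∪p∣ : (x : Fin n) (p : Subset n) → x ∉ˢ p → ∣ ⁅ x ⁆ ∪ p ∣ ≡ suc ∣ p ∣
∣⁅x⁆∪p∣ zero    (inside  ∷ p) x∉ = contradiction Vec.here x∉
∣⁅x⁆∪p∣ zero    (outside ∷ p) x∉ = cong (suc ∘ ∣_∣) (∪-identityˡ p)
∣⁅x⁆∪p∣ (suc x) (inside  ∷ p) x∉ = cong suc (∣⁅x⁆∪p∣ x p (x∉ ∘ Vec.there))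
∣⁅x⁆∪p∣ (suc x) (outside ∷ p) x∉ = ∣⁅x⁆∪p∣ x p (x∉ ∘ Vec.there)

∣pair∣≡2 : {x y : Fin n} → x ≢ y → ∣ pair x y ∣ ≡ 2
∣pair∣≡2 {x = x} {y} x≢y = trans (∣⁅x⁆∪p∣ x ⁅ y ⁆ (x≢y ∘ x∈⁅y⁆⇒x≡y y)) (cong suc (∣⁅x⁆∣≡1 y))

-- The witness is p with x deleted. The equational form lets matching on `refl` turn a set of known
-- size into a union of singletons.
extract : (x : Fin n) (p : Subset n) → x ∈ˢ p → ∃[ q ] x ∉ˢ q × p ≡ ⁅ x ⁆ ∪ q
extract zero (inside ∷ p) Vec.here =
  outside ∷ p , (λ ()) , cong (inside ∷_) (sym (∪-identityˡ p))
extract (suc x) (s ∷ p) (Vec.there x∈) with extract x p x∈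
... | q , x∉q , eq = s ∷ q , (λ { (Vec.there x∈q) → x∉q x∈q }) , cong (s ∷_) eq

extract-∣∣ : ∀ {k} (x : Fin n) (p : Subset n) → x ∈ˢ p → ∣ p ∣ ≡ suc k →
             ∃[ q ] p ≡ ⁅ x ⁆ ∪ q × ∣ q ∣ ≡ k
extract-∣∣ x p x∈p ∣p∣ with extract x p x∈p
... | q , x∉q , refl = q , refl , suc-injective (trans (sym (∣⁅x⁆∪p∣ x q x∉q)) ∣p∣)

∣p∣≡suc⇒nonempty : ∀ {k} (p : Subset n) → ∣ p ∣ ≡ suc k → Nonempty p
∣p∣≡suc⇒nonempty {n} p ∣p∣ with nonempty? p
... | yes ne = ne
... | no ¬ne with () ← trans (sym ∣p∣) (trans (cong ∣_∣ (Empty-unique ¬ne)) (∣⊥∣≡0 n))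

∣p∣≡1⇒singleton : (p : Subset n) → ∣ p ∣ ≡ 1 → ∃[ x ] p ≡ ⁅ x ⁆
∣p∣≡1⇒singleton p ∣p∣ with ∣p∣≡suc⇒nonempty p ∣p∣
... | x , x∈p with extract-∣∣ x p x∈p ∣p∣
... | q , refl , ∣q∣ with nonempty? q
... | no ¬ne = x , trans (cong (⁅ x ⁆ ∪_) (Empty-unique ¬ne)) (∪-identityʳ ⁅ x ⁆)
-- An element y would make the size of q, which is 0, a successor.
... | yes (y , y∈q) with extract y q y∈q
... | r , y∉r , refl with () ← trans (sym (∣⁅x⁆∪p∣ y r y∉r)) ∣q∣

∣p∣≡2⇒pair : (p : Subset n) → ∣ p ∣ ≡ 2 → ∃[ x ] ∃[ y ] p ≡ pair x y
∣p∣≡2⇒pair p ∣p∣ with ∣p∣≡suc⇒nonempty p ∣p∣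
... | x , x∈p with extract-∣∣ x p x∈p ∣p∣
... | q , refl , ∣q∣ with ∣p∣≡1⇒singleton q ∣q∣
... | y , refl = x , y , refl

∣p∣≡3⇒triple : {x y : Fin n} (p : Subset n) → x ≢ y → pair x y ⊆ p → ∣ p ∣ ≡ 3 →
               ∃[ z ] p ≡ triple x y z
∣p∣≡3⇒triple {x = x} {y} p x≢y xy⊆p ∣p∣ with extract-∣∣ x p (xy⊆p (∈-pairˡ x y)) ∣p∣
... | q , refl , ∣q∣ with x∈p∪q⁻ ⁅ x ⁆ q (xy⊆p (∈-pairʳ x y))
... | inj₁ y∈x = contradiction (sym (x∈⁅y⁆⇒x≡y x y∈x)) x≢y
... | inj₂ y∈q with extract-∣∣ y q y∈q ∣q∣
... | r , refl , ∣r∣ with ∣p∣≡1⇒singleton r ∣r∣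
... | z , refl = z , refl

∣pair∣≤2 : (x y : Fin n) → ∣ pair x y ∣ ≤ 2
∣pair∣≤2 x y with x ≟ y
... | no x≢y   = ≤-reflexive (∣pair∣≡2 x≢y)
... | yes refl = ≤-trans (p⊆q⇒∣p∣≤∣q∣ xx⊆x) (≤-trans (≤-reflexive (∣⁅x⁆∣≡1 x)) (s≤s z≤n))
  where
  xx⊆x : pair x x ⊆ ⁅ x ⁆
  xx⊆x v∈ with x∈p∪q⁻ ⁅ x ⁆ ⁅ x ⁆ v∈
  ... | inj₁ p = p
  ... | inj₂ p = p

-- A repeated x would squeeze the triple into `pair x z`, which has at most two elements even when x
-- and z coincide.
∣triple∣≡3⇒≢ : (x y z : Fin n) → ∣ triple x y z ∣ ≡ 3 → x ≢ y
∣triple∣≡3⇒≢ x _ z ∣xxz∣ refl =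
  <⇒≱ (≤-reflexive (sym ∣xxz∣)) (≤-trans (p⊆q⇒∣p∣≤∣q∣ xxz⊆xz) (∣pair∣≤2 x z))
  where
  xxz⊆xz : triple x x z ⊆ pair x z
  xxz⊆xz v∈ with ∈-triple⁻ v∈
  ... | inj₁ refl        = ∈-pairˡ x z
  ... | inj₂ (inj₁ refl) = ∈-pairˡ x z
  ... | inj₂ (inj₂ refl) = ∈-pairʳ x z

-- Images of triples

∈-image⁻ : (f : Fin m → Fin n) (S : Subset m) {v : Fin n} → v ∈ˢ image f S →
           ∃[ x ] x ∈ˢ S × f x ≡ v
-- Abstracting the search together with the membership equation makes the latter absurd when the
-- search fails.
∈-image⁻ f S {v} v∈ with any? (λ x → (x ∈? S) ×-dec (f x ≟ v))
                       | trans (sym (lookup∘tabulate _ v)) ([]=⇒lookup v∈)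
... | yes w | _  = w
... | no _  | ()

∈-image⁺ : (f : Fin m → Fin n) (S : Subset m) {x : Fin m} → x ∈ˢ S → f x ∈ˢ image f S
∈-image⁺ f S {x} x∈ = lookup⇒[]= (f x) _ (trans (lookup∘tabulate _ (f x))
  (dec-true (any? (λ y → (y ∈? S) ×-dec (f y ≟ f x))) (x , x∈ , refl)))

image-triple : (f : Fin m → Fin n) (x y z : Fin m) →
               image f (triple x y z) ≡ triple (f x) (f y) (f z)
image-triple f x y z = ⊆-antisym to from
  where
  to : image f (triple x y z) ⊆ triple (f x) (f y) (f z)
  to v∈ with ∈-image⁻ f (triple x y z) v∈
  ... | w , w∈ , refl with ∈-triple⁻ w∈
  ... | inj₁ refl        = ∈-triple⁺ (inj₁ refl)
  ... | inj₂ (inj₁ refl) = ∈-triple⁺ (inj₂ (inj₁ refl))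
  ... | inj₂ (inj₂ refl) = ∈-triple⁺ (inj₂ (inj₂ refl))
  from : triple (f x) (f y) (f z) ⊆ image f (triple x y z)
  from v∈ with ∈-triple⁻ v∈
  ... | inj₁ refl        = ∈-image⁺ f _ (∈-triple⁺ (inj₁ refl))
  ... | inj₂ (inj₁ refl) = ∈-image⁺ f _ (∈-triple⁺ (inj₂ (inj₁ refl)))
  ... | inj₂ (inj₂ refl) = ∈-image⁺ f _ (∈-triple⁺ (inj₂ (inj₂ refl)))

-- Links in a path-free 3-graph

module Links (G : 3Graph n) where

  -- Plays the role of z ∈ N(xy); uniformity makes the three vertices distinct.
  T : Fin n → Fin n → Fin n → Set
  T x y z = triple x y z ∈ edges G

  T? : ∀ x y z → Dec (T x y z)
  T? x y z = triple x y z ∈ᴸ? edges G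

  swap₁₂ : ∀ {x y z} → T x y z → T y x z
  swap₁₂ = subst (_∈ edges G) (triple-swap₁₂ _ _ _)

  swap₂₃ : ∀ {x y z} → T x y z → T x z y
  swap₂₃ = subst (_∈ edges G) (triple-swap₂₃ _ _ _)

  rotˡ : ∀ {x y z} → T x y z → T y z x
  rotˡ = swap₂₃ ∘ swap₁₂

  rotʳ : ∀ {x y z} → T x y z → T z x y
  rotʳ = swap₁₂ ∘ swap₂₃

  T⇒≢₁₂ : ∀ {x y z} → T x y z → x ≢ y
  T⇒≢₁₂ {x} {y} {z} t = ∣triple∣≡3⇒≢ x y z (All.lookup (uniform G) t)

  T⇒≢₂₃ : ∀ {x y z} → T x y z → y ≢ z
  T⇒≢₂₃ = T⇒≢₁₂ ∘ rotˡ

  T⇒≢₁₃ : ∀ {x y z} → T x y z → x ≢ z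
  T⇒≢₁₃ = T⇒≢₁₂ ∘ swap₂₃

  codeg : Subset n → ℕ
  codeg p = length (filter (p ⊆?_) (edges G))

  -- The distinct edges through xy outnumber the triples that xy forms with entries of `zs`, so one
  -- of these edges is none of those triples.
  third : ∀ {x y} → x ≢ y → (zs : List (Fin n)) → length zs < codeg (pair x y) →
          ∃[ z ] T x y z × z ∉ zs
  third {x} {y} x≢y zs zs<
    with pigeonhole (map (triple x y) zs) (Unique.filter⁺ (pair x y ⊆?_) (unique G))
           (subst (_< codeg (pair x y)) (sym (length-map (triple x y) zs)) zs<)
  ... | S , S∈ , S∉ with ∈-filter⁻ (pair x y ⊆?_) {xs = edges G} S∈
  ... | S∈G , xy⊆S with ∣p∣≡3⇒triple S x≢y xy⊆S (All.lookup (uniform G) S∈G)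
  ... | z , refl = z , S∈G , S∉ ∘ ∈-map⁺ (triple x y)

  T⇒∈∂ : ∀ {x y z} → T x y z → pair x y ∈ ∂ G
  T⇒∈∂ t = Equivalence.from (∈-∂ G _) (∣pair∣≡2 (T⇒≢₁₂ t) , _ , t , pair⊆triple _ _ _)

  -- Of the 15 pairs of vertices, nine lie in a common edge and are distinct by uniformity; the six
  -- inequalities treat the rest.
  path⇒P₄³ : ∀ {u v w x y z} → T u v w → T v w x → T w x y → T x y z →
             u ≢ x → u ≢ y → u ≢ z → v ≢ y → v ≢ z → w ≢ z → G Contains P₄³
  path⇒P₄³ {u} {v} {w} {x} {y} {z} uvw vwx wxy xyz u≢x u≢y u≢z v≢y v≢z w≢z =
    f , lookup-injective distinct _ _ , f-edges
    where
    vs = u ∷ v ∷ w ∷ x ∷ y ∷ z ∷ []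
    f = lookup vs
    distinct =
      (T⇒≢₁₂ uvw Vecᴬ.∷ T⇒≢₁₃ uvw Vecᴬ.∷ u≢x Vecᴬ.∷ u≢y Vecᴬ.∷ u≢z Vecᴬ.∷ Vecᴬ.[]) Vecᴾ.∷
      (T⇒≢₁₂ vwx Vecᴬ.∷ T⇒≢₁₃ vwx Vecᴬ.∷ v≢y Vecᴬ.∷ v≢z Vecᴬ.∷ Vecᴬ.[]) Vecᴾ.∷
      (T⇒≢₁₂ wxy Vecᴬ.∷ T⇒≢₁₃ wxy Vecᴬ.∷ w≢z Vecᴬ.∷ Vecᴬ.[]) Vecᴾ.∷
      (T⇒≢₁₂ xyz Vecᴬ.∷ T⇒≢₁₃ xyz Vecᴬ.∷ Vecᴬ.[]) Vecᴾ.∷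
      (T⇒≢₂₃ xyz Vecᴬ.∷ Vecᴬ.[]) Vecᴾ.∷ Vecᴬ.[] Vecᴾ.∷ Vecᴾ.[]
    image-edge : ∀ i j k → T (f i) (f j) (f k) → image f (triple i j k) ∈ edges G
    image-edge i j k = subst (_∈ edges G) (sym (image-triple f i j k))
    f-edges : ∀ {S} → S ∈ edges P₄³ → image f S ∈ edges G
    f-edges (here refl)                         = image-edge (# 0) (# 1) (# 2) uvw
    f-edges (there (here refl))                 = image-edge (# 1) (# 2) (# 3) vwx
    f-edges (there (there (here refl)))         = image-edge (# 2) (# 3) (# 4) wxy
    f-edges (there (there (there (here refl)))) = image-edge (# 3) (# 4) (# 5) xyz

  -- |N(ab)| ≥ 4, in the form in which it is used.
  Wide : Fin n → Fin n → Set
  Wide a b = ∀ u v w → ∃[ x ] T a b x × x ≢ u × x ≢ v × x ≢ w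

  Wide-sym : ∀ {a b} → Wide a b → Wide b a
  Wide-sym wide u v w with wide u v w
  ... | x , abx , ≢s = x , swap₁₂ abx , ≢s

  4≤codeg⇒Wide : ∀ {a b} → a ≢ b → 4 ≤ codeg (pair a b) → Wide a b
  4≤codeg⇒Wide a≢b 4≤ u v w with third a≢b (u ∷ v ∷ w ∷ []) 4≤
  ... | x , abx , x∉ =
    x , abx , x∉ ∘ here , x∉ ∘ there ∘ here , x∉ ∘ there ∘ there ∘ here

  -- N(bc) ∖ a has exactly one element, respectively at least two.
  Single Branching : Fin n → Fin n → Fin n → Set
  Single a b c = ∃[ d ] T b c d × d ≢ a × (∀ x → T b c x → x ≡ a ⊎ x ≡ d)
  Branching a b c = ∃[ d ] ∃[ d′ ] T b c d × T b c d′ × d ≢ a × d′ ≢ a × d ≢ d′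

  -- `another` expresses that every shadow pair has codegree at least 2.
  module _ (path-free : ¬ (G Contains P₄³))
           (another : ∀ {x y z} → T x y z → ∃[ w ] T x y w × w ≢ z) where

    N[cd]⊆ab : ∀ {a b c d e} → Wide a b → T a b c → T b c d → d ≢ a → T c d e →
               e ≡ a ⊎ e ≡ b
    N[cd]⊆ab {a} {b} {c} {d} {e} wide abc bcd d≢a cde with e ≟ a | e ≟ b
    ... | yes e≡a | _       = inj₁ e≡a
    ... | no _    | yes e≡b = inj₂ e≡b
    -- The path a′ a b c d e needs a′ to avoid c, d and e; the edge aba′ already separates it from a
    -- and b.
    ... | no e≢a  | no e≢b with wide c d e
    ... | a′ , aba′ , a′≢c , a′≢d , a′≢e =
      contradiction (path⇒P₄³ (rotʳ aba′) abc bcd cde a′≢c a′≢d a′≢e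
                       (d≢a ∘ sym) (e≢a ∘ sym) (e≢b ∘ sym)) path-free

    -- The pair cd has a neighbour besides b, and `N[cd]⊆ab` leaves only a. Used also with a and b
    -- exchanged, this yields N(ac) ∖ b = N(bc) ∖ a.
    link-transfer : ∀ {a b c d} → Wide a b → T a b c → T b c d → d ≢ a → T a c d
    link-transfer wide abc bcd d≢a with another (rotˡ bcd)
    ... | e , cde , e≢b with N[cd]⊆ab wide abc bcd d≢a cde
    ... | inj₁ refl = rotʳ cde
    ... | inj₂ e≡b  = contradiction e≡b e≢b

    single⊎branching : ∀ {a b c} → T a b c → Single a b c ⊎ Branching a b c
    single⊎branching {a} {b} {c} abc with another (rotˡ abc)
    ... | d , bcd , d≢a with any? (λ x → T? b c x ×-dec ¬? (x ≟ a) ×-dec ¬? (x ≟ d))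
    ... | yes (d′ , bcd′ , d′≢a , d′≢d) =
      inj₂ (d , d′ , bcd , bcd′ , d≢a , d′≢a , d′≢d ∘ sym)
    ... | no none = inj₁ (d , bcd , d≢a , only)
      where
      only : ∀ x → T b c x → x ≡ a ⊎ x ≡ d
      only x bcx with x ≟ a | x ≟ d
      ... | yes x≡a | _       = inj₁ x≡a
      ... | no _    | yes x≡d = inj₂ x≡d
      ... | no x≢a  | no x≢d  = contradiction (x , bcx , x≢a , x≢d) none

    -- If bcx is not an edge, take y ≢ b in N(ax). Since y x a b c d is not a path, y must equal d;
    -- the same with d′ gives d = d′, a contradiction.
    branching⇒adjacent : ∀ {a b c x} → Wide a b → T a b c → T a b x → c ≢ x →
                         Branching a b c → T b c x
    branching⇒adjacent {a} {b} {c} {x} wide abc abx c≢x (d , d′ , bcd , bcd′ , d≢a , d′≢a , d≢d′)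
      with T? b c x
    ... | yes bcx = bcx
    ... | no ¬bcx with another (swap₂₃ abx)
    ... | y , axy , y≢b =
      contradiction (trans (sym (y≡ bcd d≢a)) (y≡ bcd′ d′≢a)) d≢d′
      where
      y≢c : y ≢ c
      -- If y were c, `link-transfer` with a and b exchanged would turn the edge axc into bxc.
      y≢c refl = ¬bcx (swap₂₃ (link-transfer (Wide-sym wide) (swap₁₂ abx) axy (T⇒≢₂₃ abc ∘ sym)))
      y≡ : ∀ {d} → T b c d → d ≢ a → y ≡ d
      y≡ {d} bcd d≢a with y ≟ d
      ... | yes y≡d = y≡d
      ... | no y≢d  =
        contradiction (path⇒P₄³ (swap₁₂ (rotˡ axy)) (rotʳ abx) abc bcd
                         y≢b y≢c y≢d (c≢x ∘ sym) (λ { refl → ¬bcx bcd }) (d≢a ∘ sym))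
                      path-free

    single-exists : ∀ {a b} → Wide a b → ∃[ c ] T a b c × Single a b c
    -- Repeated arguments pad the slots: each cᵢ only has to avoid the earlier ones.
    single-exists {a} {b} wide with wide a a a
    ... | c₁ , abc₁ , _ with wide c₁ c₁ c₁
    ... | c₂ , abc₂ , c₂≢c₁ , _ with wide c₁ c₂ c₂
    ... | c₃ , abc₃ , c₃≢c₁ , c₃≢c₂ , _ with wide c₁ c₂ c₃
    ... | c₄ , abc₄ , c₄≢c₁ , c₄≢c₂ , c₄≢c₃
      with single⊎branching abc₁ | single⊎branching abc₂ | single⊎branching abc₃
    ... | inj₁ s₁ | _ | _ = c₁ , abc₁ , s₁
    ... | inj₂ _  | inj₁ s₂ | _ = c₂ , abc₂ , s₂
    ... | inj₂ _  | inj₂ _  | inj₁ s₃ = c₃ , abc₃ , s₃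
    -- Branching at c₁, c₂, c₃ joins consecutive cᵢ in the link of b, and the first two joins
    -- transfer to the link of a. This gives the edges c₁c₂a, c₂ac₃, ac₃b, c₃bc₄ of a path.
    ... | inj₂ m₁ | inj₂ m₂ | inj₂ m₃ =
      contradiction
        (path⇒P₄³ (rotˡ ac₁c₂) (swap₁₂ ac₂c₃) (swap₂₃ abc₃) (swap₁₂ bc₃c₄)
          (c₃≢c₁ ∘ sym) (T⇒≢₂₃ abc₁ ∘ sym) (c₄≢c₁ ∘ sym)
          (T⇒≢₂₃ abc₂ ∘ sym) (c₄≢c₂ ∘ sym) (T⇒≢₁₃ abc₄))
        path-free
      where
      bc₁c₂ = branching⇒adjacent wide abc₁ abc₂ (c₂≢c₁ ∘ sym) m₁
      bc₂c₃ = branching⇒adjacent wide abc₂ abc₃ (c₃≢c₂ ∘ sym) m₂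
      bc₃c₄ = branching⇒adjacent wide abc₃ abc₄ (c₄≢c₃ ∘ sym) m₃
      ac₁c₂ = link-transfer wide abc₁ bc₁c₂ (T⇒≢₁₃ abc₂ ∘ sym)
      ac₂c₃ = link-transfer wide abc₂ bc₂c₃ (T⇒≢₁₃ abc₃ ∘ sym)

-- Deleting the edges that contain a pair of P

-- A reducible configuration: deleting every edge through one of `pairs` loses at most
-- `length cover` edges and at least `length pairs` shadow pairs. `nonempty` makes the deletion
-- strict.
record Removable (G : 3Graph n) : Set where
  field
    pairs       : List (Subset n)
    cover       : List (Subset n)
    pairs-uniq  : Unique pairs
    pairs⊆∂     : All (_∈ ∂ G) pairs
    covered     : ∀ {S p} → S ∈ edges G → p ∈ pairs → p ⊆ S → S ∈ cover
    cover≤pairs : length cover ≤ length pairs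
    nonempty    : 0 < length pairs

module _ (G : 3Graph n) (P : List (Subset n)) where

  private
    keep? = λ S → ¬? (Any.any? (_⊆? S) P)

  prune : 3Graph n
  prune = record
    { edges   = filter keep? (edges G)
    ; unique  = Unique.filter⁺ keep? (unique G)
    ; uniform = All.filter⁺ keep? (uniform G)
    }

  prune-⊆ : ∀ {S} → S ∈ edges prune → S ∈ edges G
  prune-⊆ S∈ = proj₁ (∈-filter⁻ keep? {xs = edges G} S∈)

  prune-path-free : ∀ {H : 3Graph m} → ¬ (G Contains H) → ¬ (prune Contains H)
  prune-path-free free (f , f-inj , f-edges) = free (f , f-inj , λ S∈ → prune-⊆ (f-edges S∈))

  e≤e-prune+cover : ∀ {R} → (∀ {S p} → S ∈ edges G → p ∈ P → p ⊆ S → S ∈ R) →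
                    e G ≤ e prune + length R
  e≤e-prune+cover {R} covered =
    ≤-trans (Unique-⊆⇒length≤ (unique G) split) (≤-reflexive (length-++ (edges prune)))
    where
    split : ∀ {S} → S ∈ edges G → S ∈ edges prune ++ R
    split {S} S∈ with Any.any? (_⊆? S) P
    ... | no none = ∈-++⁺ˡ (∈-filter⁺ keep? S∈ none)
    ... | yes some with find some
    ... | p , p∈ , p⊆S = ∈-++⁺ʳ (edges prune) (covered S∈ p∈ p⊆S)

  -- No kept edge contains a pair of `P`, so `P` and the new shadow are disjoint parts of the old
  -- one.
  ∂-prune+P≤∂ : Unique P → All (_∈ ∂ G) P → length (∂ prune) + length P ≤ length (∂ G)
  ∂-prune+P≤∂ P-uniq P⊆∂ = ≤-trans (≤-reflexive (sym (length-++ (∂ prune))))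
    (Unique-⊆⇒length≤ (Unique.++⁺ (∂-unique prune) P-uniq disjoint) join)
    where
    disjoint : ∀ {p} → ¬ (p ∈ ∂ prune × p ∈ P)
    disjoint (p∈∂ , p∈P) with Equivalence.to (∈-∂ prune _) p∈∂
    ... | _ , S , S∈ , p⊆S =
      proj₂ (∈-filter⁻ keep? {xs = edges G} S∈) (lose p∈P (λ {x} → p⊆S {x}))
    join : ∀ {p} → p ∈ ∂ prune ++ P → p ∈ ∂ G
    join p∈ with ∈-++⁻ (∂ prune) p∈
    ... | inj₂ p∈P = All.lookup P⊆∂ p∈P
    ... | inj₁ p∈∂ with Equivalence.to (∈-∂ prune _) p∈∂
    ... | ∣p∣ , S , S∈ , p⊆S = Equivalence.from (∈-∂ G _) (∣p∣ , S , prune-⊆ S∈ , p⊆S)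

  -- A shadow pair lies in some edge, and that edge is deleted.
  e-prune<e : ∀ {p} → p ∈ P → p ∈ ∂ G → e prune < e G
  e-prune<e p∈P p∈∂ with Equivalence.to (∈-∂ G _) p∈∂
  ... | _ , S , S∈ , p⊆S =
    filter-notAll keep? (edges G) (lose S∈ λ keep → keep (lose p∈P (λ {x} → p⊆S {x})))

-- The trichotomy on codegrees

module _ (G : 3Graph n) where
  open Links G

  codeg≤1⇒removable : ∀ {p} → p ∈ ∂ G → codeg p ≤ 1 → Removable G
  codeg≤1⇒removable {p} p∈ codeg≤1 = record
    { pairs       = p ∷ []
    ; cover       = filter (p ⊆?_) (edges G)
    ; pairs-uniq  = All.[] ∷ []
    ; pairs⊆∂     = p∈ All.∷ All.[]
    ; covered     = λ { S∈ (here refl) p⊆S → ∈-filter⁺ (p ⊆?_) S∈ p⊆S }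
    ; cover≤pairs = codeg≤1
    ; nonempty    = s≤s z≤n
    }

  ∈∂⇒pair : ∀ {p} → p ∈ ∂ G → ∃[ a ] ∃[ b ] a ≢ b × p ≡ pair a b
  ∈∂⇒pair {p} p∈ with Equivalence.to (∈-∂ G _) p∈
  ... | ∣p∣ , _ with ∣p∣≡2⇒pair p ∣p∣
  ... | a , b , refl = a , b , a≢b , refl
    where
    a≢b : a ≢ b
    -- A pair with equal entries collapses to a singleton, of size 1 instead of 2.
    a≢b refl with () ← trans (sym ∣p∣) (trans (cong ∣_∣ (∪-idem ⁅ a ⁆)) (∣⁅x⁆∣≡1 a))

  module _ (path-free : ¬ (G Contains P₄³))
           (another : ∀ {x y z} → T x y z → ∃[ w ] T x y w × w ≢ z) where

    wide⇒removable : ∀ {a b} → Wide a b → Removable G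
    wide⇒removable {a} {b} wide with single-exists path-free another wide
    ... | c , abc , d , bcd , d≢a , N[bc] = record
      -- With c written second throughout, the first vertex of a pair witnesses that it differs from
      -- the later ones, as `pair-≢` requires.
      { pairs       = pair a c ∷ pair b c ∷ pair d c ∷ []
      ; cover       = triple a b c ∷ triple a c d ∷ triple b c d ∷ []
      ; pairs-uniq  = (pair-≢ a≢b a≢c All.∷ pair-≢ (d≢a ∘ sym) a≢c All.∷ All.[])
                    ∷ (pair-≢ (T⇒≢₁₃ bcd) (T⇒≢₁₂ bcd) All.∷ All.[]) ∷ All.[] ∷ []
      ; pairs⊆∂     = T⇒∈∂ acb All.∷ T⇒∈∂ bcd All.∷ T⇒∈∂ (swap₁₂ (rotˡ bcd)) All.∷ All.[]
      ; covered     = covered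
      ; cover≤pairs = ≤-refl
      ; nonempty    = s≤s z≤n
      }
      where
      a≢b = T⇒≢₁₂ abc
      a≢c = T⇒≢₁₃ abc
      acb = swap₂₃ abc
      acd = link-transfer path-free another wide abc bcd d≢a
      covers : Subset n → Set
      covers S = S ∈ triple a b c ∷ triple a c d ∷ triple b c d ∷ []
      N[ac] : ∀ x → T a c x → covers (triple a c x)
      N[ac] x acx with x ≟ b
      ... | yes refl = here (triple-swap₂₃ a c b)
      -- With a and b exchanged, `link-transfer` puts x into N(bc), which consists of a and d; the
      -- edge acx rules out a.
      ... | no x≢b with N[bc] x (link-transfer path-free another (Wide-sym wide) (swap₁₂ abc) acx x≢b)
      ... | inj₁ refl = contradiction refl (T⇒≢₁₃ acx)
      ... | inj₂ refl = there (here refl)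
      covered : ∀ {S p} → S ∈ edges G → p ∈ pair a c ∷ pair b c ∷ pair d c ∷ [] → p ⊆ S → covers S
      covered {S} S∈ (here refl) p⊆S
        with ∣p∣≡3⇒triple S a≢c p⊆S (All.lookup (uniform G) S∈)
      ... | x , refl = N[ac] x S∈
      covered {S} S∈ (there (here refl)) p⊆S
        with ∣p∣≡3⇒triple S (T⇒≢₁₂ bcd) p⊆S (All.lookup (uniform G) S∈)
      ... | x , refl with N[bc] x S∈
      ... | inj₁ refl = here (trans (triple-swap₂₃ b c a) (triple-swap₁₂ b a c))
      ... | inj₂ refl = there (there (here refl))
      covered {S} S∈ (there (there (here refl))) p⊆S
        with ∣p∣≡3⇒triple S (T⇒≢₂₃ bcd ∘ sym) p⊆S (All.lookup (uniform G) S∈)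
      ... | x , refl with N[cd]⊆ab path-free another wide abc bcd d≢a (swap₁₂ S∈)
      ... | inj₁ refl = there (here (trans (triple-swap₂₃ d c a)
                          (trans (triple-swap₁₂ d a c) (triple-swap₂₃ a d c))))
      ... | inj₂ refl = there (there (here (trans (triple-swap₂₃ d c b)
                          (trans (triple-swap₁₂ d b c) (triple-swap₂₃ b d c)))))

  3≤∂-degree : ∀ {S} → S ∈ edges G → 3 ≤ length (filter (_⊆? S) (∂ G))
  3≤∂-degree {S} S∈ with ∣p∣≡suc⇒nonempty S (All.lookup (uniform G) S∈)
  ... | x , x∈S with extract-∣∣ x S x∈S (All.lookup (uniform G) S∈)
  ... | q , refl , ∣q∣ with ∣p∣≡2⇒pair q ∣q∣
  ... | y , z , refl = Unique-⊆⇒length≤ uniq sides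
    where
    sides : ∀ {p} → p ∈ pair x y ∷ pair x z ∷ pair y z ∷ [] → p ∈ filter (_⊆? triple x y z) (∂ G)
    sides (here refl) = ∈-filter⁺ (_⊆? _) (T⇒∈∂ S∈) (pair⊆triple x y z)
    sides (there (here refl)) = ∈-filter⁺ (_⊆? _) (T⇒∈∂ (swap₂₃ S∈))
      (subst (pair x z ⊆_) (triple-swap₂₃ x z y) (pair⊆triple x z y))
    sides (there (there (here refl))) =
      ∈-filter⁺ (_⊆? _) (T⇒∈∂ (rotˡ S∈)) (q⊆p∪q ⁅ x ⁆ (pair y z))
    uniq : Unique (pair x y ∷ pair x z ∷ pair y z ∷ [])
    -- xy and xz share their first vertex, so xy is flipped to let y be the vertex outside xz.
    uniq = ((λ eq → pair-≢ (T⇒≢₁₂ S∈ ∘ sym) (T⇒≢₂₃ S∈) (trans (pair-comm y x) eq))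
              All.∷ pair-≢ (T⇒≢₁₂ S∈) (T⇒≢₁₃ S∈) All.∷ All.[])
         ∷ (pair-≢ (T⇒≢₁₂ S∈) (T⇒≢₁₃ S∈) All.∷ All.[]) ∷ All.[] ∷ []

  -- Counts inclusions of shadow pairs in edges: each edge contains its three sides, and each pair
  -- lies in at most three edges.
  codeg≤3⇒e≤∂ : All (λ p → codeg p ≤ 3) (∂ G) → e G ≤ length (∂ G)
  codeg≤3⇒e≤∂ codeg≤3 = *-cancelʳ-≤ _ _ 3
    (double-count _⊆?_ 3 3 codeg≤3 (All.tabulate 3≤∂-degree))

  removable⊎e≤∂ : ¬ (G Contains P₄³) → Removable G ⊎ e G ≤ length (∂ G)
  removable⊎e≤∂ path-free with Any.any? (λ p → codeg p ≤? 1) (∂ G)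
  ... | yes some with find some
  ... | p , p∈ , codeg≤1 = inj₁ (codeg≤1⇒removable p∈ codeg≤1)
  removable⊎e≤∂ path-free | no none with All.all? (λ p → codeg p ≤? 3) (∂ G)
  ... | yes codeg≤3 = inj₂ (codeg≤3⇒e≤∂ codeg≤3)
  ... | no ¬codeg≤3 with find (All.¬All⇒Any¬ (λ p → codeg p ≤? 3) (∂ G) ¬codeg≤3)
  ... | p , p∈ , codeg≰3 with ∈∂⇒pair p∈
  ... | a , b , a≢b , refl =
    inj₁ (wide⇒removable path-free another (4≤codeg⇒Wide a≢b (≰⇒> codeg≰3)))
    where
    -- The failed search for a pair of codegree at most 1 leaves xy with a second edge, whose third
    -- vertex avoids z.
    another : ∀ {x y z} → T x y z → ∃[ w ] T x y w × w ≢ z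
    another {z = z} t
      with third (T⇒≢₁₂ t) (z ∷ []) (≰⇒> (λ codeg≤1 → none (lose (T⇒∈∂ t) codeg≤1)))
    ... | w , xyw , w∉ = w , xyw , w∉ ∘ here

-- Induction on the number of edges

-- The minimal counterexample becomes well-founded recursion: `prune` stays path-free with fewer
-- edges, and the bound for it lifts back because at most as many edges as shadow pairs were lost.
e≤∂ : (G : 3Graph n) → ¬ (G Contains P₄³) → Acc _<_ (e G) → e G ≤ length (∂ G)
e≤∂ G path-free (acc smaller) with removable⊎e≤∂ G path-free
... | inj₂ e≤      = e≤
-- The field `nonempty` excludes an empty `pairs`; the head p later witnesses that an edge
-- disappears.
... | inj₁ record { pairs = p ∷ P ; cover = R ; pairs-uniq = uniq ; pairs⊆∂ = P⊆∂
                  ; covered = covered ; cover≤pairs = R≤P } = begin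
  e G                                           ≤⟨ e≤e-prune+cover G (p ∷ P) covered ⟩
  e (prune G (p ∷ P)) + length R                ≤⟨ +-mono-≤ ih R≤P ⟩
  length (∂ (prune G (p ∷ P))) + suc (length P) ≤⟨ ∂-prune+P≤∂ G (p ∷ P) uniq P⊆∂ ⟩
  length (∂ G)                                  ∎
  where
  open ≤-Reasoning
  ih = e≤∂ (prune G (p ∷ P)) (prune-path-free G (p ∷ P) {H = P₄³} path-free)
         (smaller (e-prune<e G (p ∷ P) (here refl) (All.lookup P⊆∂ (here refl))))

lemma5p1 : ∀ (n : ℕ) → 5 ≤ n → (G : 3Graph n) → ¬ (G Contains P₄³) → e G ≤ length (∂ G)
lemma5p1 n _ G path-free = e≤∂ G path-free (<-wellFounded (e G))
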